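{- Let $k \geq 1$ be an integer and let $G$ be a connected graph. If $\chi_c(G) = \frac{2k+1}{k}$, then $G$ folds to $C_{2k+1}$. Furthermore, any graph which folds to $C_{2k+1}$ is $C_{2k+1}$-colourable.
   Context: Graphs are finite and simple; $C_n$ is the cycle on $n$ vertices. An $H$-colouring of $G$ is a homomorphism $G \to H$; $G$ is $H$-colourable if one exists. For positive integers $p,q$ with $p/q \ge 2$, a $(p,q)$-colouring of $G$ is a map $f: V(G) \to \{0,\dots,p-1\}$ with $q \le |f(u)-f(v)| \le p-q$ for every edge $uv$. The circular chromatic number $\chi_c(G)$ is the minimum of $p/q$ over all such $p,q$ for which $G$ has a $(p,q)$-colouring. For vertices $x,y$ of $G$ at distance exactly $2$, let $G_{xy}$ be the (simple) graph obtained by identifying $x$ and $y$ into a new vertex $v_{xy}$; the homomorphism $G\to G_{xy}$ sending $x,y\mapsto v_{xy}$ and fixing all other vertices is an elementary fold. $G$ folds to $H$ if there is a homomorphism $f: G\to H$ which is a composition of (zero or more) elementary folds with $f(G)$ isomorphic to $H$. -}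

module Defs where

open import Data.Fin.Base using (Fin; toℕ; punchOut)
open import Data.Fin.Properties using (any?; punchOut-injective)
import Data.Fin.Properties as Fin
open import Data.Integer.Base using (+_)
open import Data.Nat.Base using (ℕ; zero; suc; _+_; _*_; _∸_; _≤_; z≤n; s≤s; ∣_-_∣; NonZero)
import Data.Nat.Properties as ℕ
open import Data.Product.Base using (Σ; Σ-syntax; ∃; ∃-syntax; _×_; _,_)
open import Data.Rational.Base using (ℚ; _/_) renaming (_≤_ to _≤ᵣ_)
open import Data.Sum.Base using (_⊎_; inj₁; inj₂; swap)
open import Function.Base using (id; _∘_)
open import Function.Bundles using (_⇔_)
open import Function.Definitions using (Injective)
open import Level using (0ℓ)
open import Relation.Binary.Core using (Rel)
open import Relation.Binary.Definitions using (Symmetric; Decidable)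
open import Relation.Binary.PropositionalEquality
  using (_≡_; _≢_; refl; sym; trans; cong; subst)
open import Relation.Nullary.Decidable using (Dec; yes; no; _×-dec_; _⊎-dec_)
open import Relation.Nullary.Negation using (¬_; contradiction)

-- Adjacency is required to be decidable, as it is for any finite graph
-- classically.

record Graph (n : ℕ) : Set₁ where
  field
    Adj    : Rel (Fin n) 0ℓ
    adj?   : Decidable Adj
    symm   : Symmetric Adj
    irrefl : ∀ {v} → ¬ Adj v v

open Graph public

private
  variable
    l m n : ℕ

data Walk (G : Graph n) : Fin n → Fin n → ℕ → Set where
  []  : ∀ {u} → Walk G u u 0
  _∷_ : ∀ {u v w d} → Adj G u v → Walk G v w d → Walk G u w (suc d)

Connected : Graph n → Set
Connected {n} G = (u v : Fin n) → ∃[ d ] Walk G u v d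

record Distance (G : Graph n) (x y : Fin n) (d : ℕ) : Set where
  field
    walk     : Walk G x y d
    shortest : ∀ {e} → Walk G x y e → d ≤ e

open Distance public

infix 4 _⇒_
infixr 9 _∘ₕ_

record _⇒_ (G : Graph m) (H : Graph n) : Set where
  field
    map       : Fin m → Fin n
    preserves : ∀ {u v} → Adj G u v → Adj H (map u) (map v)

open _⇒_ public

idₕ : {G : Graph n} → G ⇒ G
idₕ .map       = id
idₕ .preserves = id

_∘ₕ_ : {G : Graph l} {H : Graph m} {K : Graph n} → H ⇒ K → G ⇒ H → G ⇒ K
(g ∘ₕ f) .map       = map g ∘ map f
(g ∘ₕ f) .preserves = preserves g ∘ preserves f

_-Colourable_ : Graph n → Graph m → Set
H -Colourable G = G ⇒ H

-- No reduction modulo n is needed: the vertex following the last one is 0.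

data Next (n : ℕ) (i j : Fin n) : Set where
  step : suc (toℕ i) ≡ toℕ j → Next n i j
  wrap : suc (toℕ i) ≡ n → toℕ j ≡ 0 → Next n i j

next? : Decidable (Next n)
next? {n} i j with suc (toℕ i) ℕ.≟ toℕ j | suc (toℕ i) ℕ.≟ n | toℕ j ℕ.≟ 0
... | yes p | _     | _     = yes (step p)
... | no _  | yes q | yes r = yes (wrap q r)
... | no ¬p | yes _ | no ¬r = no λ { (step p) → ¬p p ; (wrap _ r) → ¬r r }
... | no ¬p | no ¬q | _     = no λ { (step p) → ¬p p ; (wrap q _) → ¬q q }

next-irrefl : 3 ≤ n → {i : Fin n} → ¬ Next n i i
next-irrefl 3≤n (step p)   = ℕ.1+n≢n p
next-irrefl 3≤n (wrap p q) with trans (sym p) (cong suc q)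
next-irrefl (s≤s ()) (wrap p q) | refl

cycle : (n : ℕ) → 3 ≤ n → Graph n
cycle n 3≤n .Adj i j = Next n i j ⊎ Next n j i
cycle n 3≤n .adj? i j = next? i j ⊎-dec next? j i
cycle n 3≤n .symm = swap
cycle n 3≤n .irrefl (inj₁ e) = next-irrefl 3≤n e
cycle n 3≤n .irrefl (inj₂ e) = next-irrefl 3≤n e

C[2_+1] : (k : ℕ) .{{_ : NonZero k}} → Graph (2 * k + 1)
C[2 suc k +1] = cycle (2 * suc k + 1) (ℕ.+-monoˡ-≤ 1 (ℕ.*-monoʳ-≤ 2 (s≤s (z≤n {k}))))

record CircularColouring (p q : ℕ) (G : Graph n) : Set where
  field
    colour : Fin n → Fin p
    lower  : ∀ {u v} → Adj G u v → q ≤ ∣ toℕ (colour u) - toℕ (colour v) ∣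
    upper  : ∀ {u v} → Adj G u v → ∣ toℕ (colour u) - toℕ (colour v) ∣ ≤ p ∸ q

-- r = p / q for some positive p, q with p / q ≥ 2 such that G has a
-- (p , q)-colouring; positivity of p follows from that of q and 2q ≤ p.

record CircularRatio (G : Graph n) (r : ℚ) : Set where
  field
    p q       : ℕ
    {{q≢0}}   : NonZero q
    2q≤p      : 2 * q ≤ p
    colouring : CircularColouring p q G
    ratio     : r ≡ + p / q

-- Stated as a relation, so that existence of the minimum is not built in.

χc[_]≡_ : Graph n → ℚ → Set
χc[ G ]≡ r = CircularRatio G r × (∀ {s} → CircularRatio G s → r ≤ᵣ s)

-- The map identifying y with x.  The image of x plays the role of v_xy, and
-- the vertices other than y are renumbered by punchOut.

identify : {x y : Fin (suc n)} → y ≢ x → Fin (suc n) → Fin n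
identify {y = y} y≢x v with y Fin.≟ v
... | yes _  = punchOut y≢x
... | no y≢v = punchOut y≢v

identify-fibre : {x y : Fin (suc n)} (y≢x : y ≢ x) (u v : Fin (suc n)) →
                 identify y≢x u ≡ identify y≢x v →
                 u ≡ v ⊎ (u ≡ x × v ≡ y) ⊎ (u ≡ y × v ≡ x)
identify-fibre {y = y} y≢x u v eq with y Fin.≟ u | y Fin.≟ v
... | yes y≡u | yes y≡v = inj₁ (trans (sym y≡u) y≡v)
... | yes y≡u | no y≢v  = inj₂ (inj₂ (sym y≡u , sym (punchOut-injective y≢x y≢v eq)))
... | no y≢u  | yes y≡v = inj₂ (inj₁ (punchOut-injective y≢u y≢x eq , sym y≡v))
... | no y≢u  | no y≢v  = inj₁ (punchOut-injective y≢u y≢v eq)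

distance2⇒≢ : (G : Graph n) {x y : Fin n} → Distance G x y 2 → y ≢ x
distance2⇒≢ G d refl with () ← shortest d []

distance2⇒¬Adj : (G : Graph n) {x y : Fin n} → Distance G x y 2 → ¬ Adj G x y
distance2⇒¬Adj G d e with s≤s () ← shortest d (e ∷ [])

module _ (G : Graph (suc n)) {x y : Fin (suc n)} (d : Distance G x y 2) where

  private
    π : Fin (suc n) → Fin n
    π = identify (distance2⇒≢ G d)

  identified : Graph n
  identified .Adj a b = ∃[ u ] ∃[ v ] π u ≡ a × π v ≡ b × Adj G u v
  identified .adj? a b =
    any? λ u → any? λ v → π u Fin.≟ a ×-dec π v Fin.≟ b ×-dec adj? G u v
  identified .symm (u , v , p , q , e) = v , u , q , p , symm G e
  identified .irrefl (u , v , p , q , e)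
    with identify-fibre (distance2⇒≢ G d) u v (trans p (sym q))
  ... | inj₁ refl                 = irrefl G e
  ... | inj₂ (inj₁ (refl , refl)) = distance2⇒¬Adj G d e
  ... | inj₂ (inj₂ (refl , refl)) = distance2⇒¬Adj G d (symm G e)

  elementaryFold : G ⇒ identified
  elementaryFold .map = π
  elementaryFold .preserves {u} {v} e = u , v , refl , refl , e

data IsFold : {G : Graph m} {H : Graph n} → G ⇒ H → Set₁ where
  none : {G : Graph n} → IsFold (idₕ {G = G})
  fold : {G : Graph (suc m)} {H : Graph n} {x y : Fin (suc m)} (d : Distance G x y 2)
         {f : identified G d ⇒ H} → IsFold f → IsFold (f ∘ₕ elementaryFold G d)

-- An isomorphism from H to the subgraph f(G) of G′, whose vertices and edges
-- are the images of those of G.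

record ImageIso {G : Graph l} {G′ : Graph m} (f : G ⇒ G′) (H : Graph n) : Set where
  field
    to        : Fin n → Fin m
    injective : Injective _≡_ _≡_ to
    vertices  : ∀ w → (∃[ a ] to a ≡ w) ⇔ (∃[ u ] map f u ≡ w)
    edges     : ∀ a b → Adj H a b ⇔
                        (∃[ u ] ∃[ v ] map f u ≡ to a × map f v ≡ to b × Adj G u v)

_FoldsTo_ : Graph m → Graph n → Set₁
G FoldsTo H = ∃[ l ] Σ[ G′ ∈ Graph l ] Σ[ f ∈ G ⇒ G′ ] IsFold f × ImageIso f H

{-# OPTIONS --safe #-}

-- Scaling a colouring attaining χ_c(G) = (2k+1)/k down to a (2k+1, k)-colouring
-- gives a homomorphism G → C_{2k+1}.  As long as some vertex has two neighbours
-- of the same colour, these can be folded together and the homomorphism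
-- descends.  Once no such pair is left, orienting each edge along the cycle
-- gives every vertex at most one successor and at most one predecessor, so the
-- connected graph reached is a path or a cycle C_N with N ≥ 2k+1.  Paths, even
-- cycles and odd cycles with N > 2k+1 have χ_c < (2k+1)/k, and a colouring of the
-- folded graph pulls back to G; hence N = 2k+1.

module Submission where

open import Defs
open import Data.Nat.Base
  using (ℕ; zero; suc; _+_; _*_; _∸_; _≤_; _<_; z≤n; s≤s; s<s⁻¹; z<s; ∣_-_∣; NonZero)
  renaming (_/_ to _div_)
open import Data.Fin.Base using (Fin; zero; suc; toℕ; fromℕ<; opposite; punchIn; punchOut)
import Data.Fin.Properties as Fin
open import Data.Integer.Base using (+_)
import Data.Integer.Base as ℤ
import Data.Integer.Properties as ℤ
open import Data.Nat.Divisibility using (divides; ∣m+n∣m⇒∣n; m∣m*n; n∣m*n)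
open import Data.Nat.DivMod using (/-monoˡ-≤; +-distrib-/-∣ʳ; m*n/n≡m; m<n*o⇒m/o<n)
open import Data.Nat.GeneralisedArithmetic using () renaming (fold to iterate)
import Data.Nat.Properties as ℕ
open import Data.Nat.Tactic.RingSolver using (solve-∀)
open import Data.Product.Base using (∃-syntax; Σ-syntax; _×_; _,_; proj₁; proj₂)
open import Data.Rational.Base using (_/_) renaming (_≤_ to _≤ᵣ_)
open import Data.Rational.Properties using (/-injective-≃; toℚᵘ-fromℚᵘ; toℚᵘ-mono-≤)
open import Data.Rational.Unnormalised.Base using (mkℚᵘ; *≡*)
import Data.Rational.Unnormalised.Properties as ℚᵘ
open import Data.Sum.Base using (_⊎_; inj₁; inj₂; swap)
open import Function.Base using (_∘_; case_of_)
open import Function.Bundles using (mk⇔; Equivalence)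
open import Level using (0ℓ)
open import Relation.Binary.PropositionalEquality
  using (_≡_; _≢_; refl; sym; trans; cong; subst; subst₂; module ≡-Reasoning)
open import Relation.Nullary.Decidable using (Dec; yes; no; ¬?; _×-dec_; decidable-stable)
open import Relation.Nullary.Negation using (¬_; contradiction)
open import Relation.Unary using (Pred; Decidable)

private
  variable
    m n p q t M N : ℕ
    G H : Graph n

-- Arithmetic preliminaries and the cyclic successor relation.

<-suc∃ : m < n → ∃[ d ] m + suc d ≡ n
<-suc∃ {m} m<n with ℕ.m≤n⇒∃[o]m+o≡n m<n
... | d , eq = d , trans (ℕ.+-suc m d) eq

half : ∀ n → ∃[ t ] (n ≡ t + t ⊎ n ≡ suc (t + t))
half zero = 0 , inj₁ refl
half (suc n) with half n
... | t , inj₁ refl = t , inj₂ refl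
... | t , inj₂ refl = suc t , inj₁ (cong suc (sym (ℕ.+-suc t t)))

least : {P : Pred ℕ 0ℓ} → Decidable P → P n → ∃[ m ] P m × (∀ {i} → i < m → ¬ P i)
least {zero} P? Pn = 0 , Pn , λ ()
least {suc n} P? Pn with P? 0
... | yes P0 = 0 , P0 , λ ()
... | no ¬P0 with least (P? ∘ suc) Pn
...   | m , Pm , below = suc m , Pm , λ { {zero} _ → ¬P0 ; {suc i} i<m → below (s<s⁻¹ i<m) }

next-functional : {i j j′ : Fin M} → Next M i j → Next M i j′ → j ≡ j′
next-functional (step p) (step q) = Fin.toℕ-injective (trans (sym p) q)
next-functional {j = j} (step p) (wrap q _) = contradiction (trans (sym p) q) (ℕ.<⇒≢ (Fin.toℕ<n j))
next-functional {j′ = j} (wrap q _) (step p) = contradiction (trans (sym p) q) (ℕ.<⇒≢ (Fin.toℕ<n j))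
next-functional (wrap _ p) (wrap _ q) = Fin.toℕ-injective (trans p (sym q))

next-injective : {i i′ j : Fin M} → Next M i j → Next M i′ j → i ≡ i′
next-injective (step p) (step q) = Fin.toℕ-injective (ℕ.suc-injective (trans p (sym q)))
next-injective (step p) (wrap _ q) = contradiction (trans p q) λ ()
next-injective (wrap _ q) (step p) = contradiction (trans p q) λ ()
next-injective (wrap p _) (wrap q _) = Fin.toℕ-injective (ℕ.suc-injective (trans p (sym q)))

-- Congruence modulo `M` with an explicit multiple: `c` is 1 exactly when the edge wraps around, so
-- the `c` can be summed along a walk to count its turns.
next-toℕ : {i j : Fin M} → Next M i j → ∃[ c ] suc (toℕ i) ≡ toℕ j + c * M
next-toℕ {j = j} (step p) = 0 , trans p (sym (ℕ.+-identityʳ (toℕ j)))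
next-toℕ {M} (wrap p q) rewrite q = 1 , trans p (sym (ℕ.+-identityʳ M))

-- Circular colourings, and explicit ones for even and odd cycles.

pullback : G ⇒ H → CircularColouring p q H → CircularColouring p q G
pullback f c = record
  { colour = colour ∘ map f
  ; lower  = lower ∘ preserves f
  ; upper  = upper ∘ preserves f
  }
  where open CircularColouring c

record Between (q p d : ℕ) : Set where
  constructor between
  field
    lower : q ≤ d
    upper : d ≤ p ∸ q

-- The distance of two colours is symmetric, so each edge need only be checked in one direction.
orientedColouring : {_↝_ : Fin n → Fin n → Set} →
                    (∀ {u v} → Adj G u v → u ↝ v ⊎ v ↝ u) → (c : Fin n → Fin p) →
                    (∀ {u v} → u ↝ v → Between q p ∣ toℕ (c u) - toℕ (c v) ∣) →
                    CircularColouring p q G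
orientedColouring {G = G} {p = p} {q = q} orient c ok = record
  { colour = c
  ; lower  = Between.lower ∘ ok′
  ; upper  = Between.upper ∘ ok′
  }
  where
  ok′ : ∀ {u v} → Adj G u v → Between q p ∣ toℕ (c u) - toℕ (c v) ∣
  ok′ {u} {v} e with orient e
  ... | inj₁ u↝v = ok u↝v
  ... | inj₂ v↝u = subst (Between q p) (ℕ.∣-∣-comm (toℕ (c v)) (toℕ (c u))) (ok v↝u)

alternate : ℕ → Fin 2
alternate zero    = zero
alternate (suc n) = opposite (alternate n)

alternate-double : ∀ t → alternate (t + t) ≡ zero
alternate-double zero = refl
alternate-double (suc t) rewrite ℕ.+-suc t t | alternate-double t = refl

between-alternate : ∀ (c : Fin 2) {d} → d ≡ opposite c → Between 1 2 ∣ toℕ c - toℕ d ∣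
between-alternate zero       refl = between ℕ.≤-refl ℕ.≤-refl
between-alternate (suc zero) refl = between ℕ.≤-refl ℕ.≤-refl

cycle-even : (3≤N : 3 ≤ N) → N ≡ t + t → CircularColouring 2 1 (cycle N 3≤N)
cycle-even {N} {t} 3≤N N≡2t = orientedColouring (λ e → e) (alternate ∘ toℕ) ok
  where
  ok : {i j : Fin N} → Next N i j →
       Between 1 2 ∣ toℕ (alternate (toℕ i)) - toℕ (alternate (toℕ j)) ∣
  ok {i} (step p) = between-alternate (alternate (toℕ i)) (cong alternate (sym p))
  ok {i} (wrap p q) = between-alternate (alternate (toℕ i))
    (trans (cong alternate q)
      (trans (sym (alternate-double t)) (cong alternate (trans (sym N≡2t) (sym p)))))

-- Vertex j of C_{2t+1} gets the colour -t j modulo 2t+1.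

halfTurn : ℕ → ℕ → ℕ
halfTurn t zero          = 0
halfTurn t (suc zero)    = suc t
halfTurn t (suc (suc j)) = suc (halfTurn t j)

-- Moving two places on raises both values by one, so the difference depends only on the parity of
-- `j`.
halfTurn-step : ∀ t j → let d = ∣ halfTurn t j - halfTurn t (suc j) ∣ in d ≡ t ⊎ d ≡ suc t
halfTurn-step t zero          = inj₂ refl
halfTurn-step t (suc zero)    = inj₁ (ℕ.∣-∣-identityʳ t)
halfTurn-step t (suc (suc j)) = halfTurn-step t j

halfTurn-double : ∀ t j → halfTurn t (j + j) ≡ j
halfTurn-double t zero = refl
halfTurn-double t (suc j) rewrite ℕ.+-suc j j = cong suc (halfTurn-double t j)

-- Doubling avoids halving `j`: the value is `i` at `j = 2i` and `t + 1 + i` at `j = 2i + 1`, where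
-- the bound is attained.
halfTurn-bound : ∀ t j → halfTurn t j + halfTurn t j ≤ suc (t + t) + j
halfTurn-bound t zero          = z≤n
halfTurn-bound t (suc zero)    = ℕ.≤-reflexive (lemma t)
  where
  lemma : ∀ t → suc t + suc t ≡ suc (t + t) + 1
  lemma = solve-∀
halfTurn-bound t (suc (suc j)) =
  subst₂ _≤_ (sym (cong suc (ℕ.+-suc _ _))) (lemma t j) (s≤s (s≤s (halfTurn-bound t j)))
  where
  lemma : ∀ t j → suc (suc (suc (t + t) + j)) ≡ suc (t + t) + suc (suc j)
  lemma = solve-∀

double-cancel-≤ : ∀ {m n} → m + m ≤ suc (n + n) → m ≤ n
double-cancel-≤ {m} {n} le = ℕ.≮⇒≥ λ n<m →
  ℕ.<⇒≱ (subst (_≤ m + m) (cong suc (ℕ.+-suc n n)) (ℕ.+-mono-≤ n<m n<m)) le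

halfTurn-< : ∀ t {j} → j < suc (t + t) → halfTurn t j < suc (t + t)
halfTurn-< t {j} (s≤s j≤2t) =
  s≤s (double-cancel-≤ (ℕ.≤-trans (halfTurn-bound t j) (ℕ.+-monoʳ-≤ (suc (t + t)) j≤2t)))

cycle-odd : (3≤N : 3 ≤ N) → N ≡ suc (t + t) → CircularColouring N t (cycle N 3≤N)
cycle-odd {N} {t} 3≤N refl =
  orientedColouring (λ e → e) (λ i → fromℕ< (halfTurn-< t (Fin.toℕ<n i))) ok
  where
  upper : suc t ≤ N ∸ t
  upper = ℕ.≤-reflexive (sym (ℕ.m+n∸n≡m (suc t) t))

  near : ∀ {d} → d ≡ t ⊎ d ≡ suc t → Between t N d
  near (inj₁ refl) = between ℕ.≤-refl (ℕ.≤-trans (ℕ.n≤1+n t) upper)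
  near (inj₂ refl) = between (ℕ.n≤1+n t) upper

  ok : {i j : Fin N} → Next N i j → Between t N
         ∣ toℕ (fromℕ< (halfTurn-< t (Fin.toℕ<n i))) - toℕ (fromℕ< (halfTurn-< t (Fin.toℕ<n j))) ∣
  ok {i} {j} e rewrite Fin.toℕ-fromℕ< (halfTurn-< t (Fin.toℕ<n i))
                     | Fin.toℕ-fromℕ< (halfTurn-< t (Fin.toℕ<n j)) with e
  ... | step p rewrite sym p = near (halfTurn-step t (toℕ i))
  -- The closing edge joins vertex `2t`, of colour `t`, to vertex 0, of colour 0.
  ... | wrap p q rewrite q | ℕ.suc-injective p | halfTurn-double t t =
    near (inj₁ (ℕ.∣-∣-identityʳ t))

-- Connected graphs with a locally injective homomorphism to a cycle.

LocallyInjective : {G : Graph m} {H : Graph n} → G ⇒ H → Set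
LocallyInjective {G = G} f = ∀ {u v w} → Adj G w u → Adj G w v → map f u ≡ map f v → u ≡ v

record Isomorphism (H : Graph m) (G : Graph n) : Set where
  field
    to         : Fin m → Fin n
    injective  : ∀ {i j} → to i ≡ to j → i ≡ j
    from       : Fin n → Fin m
    to-from    : ∀ u → to (from u) ≡ u
    preserves  : ∀ {i j} → Adj H i j → Adj G (to i) (to j)
    reflects   : ∀ {i j} → Adj G (to i) (to j) → Adj H i j

  fromₕ : G ⇒ H
  fromₕ .map = from
  fromₕ .preserves {u} {v} e = reflects (subst₂ (Adj G) (sym (to-from u)) (sym (to-from v)) e)

module _ {G : Graph n} (3≤M : 3 ≤ M) (connected : Connected G)
         (f : G ⇒ cycle M 3≤M) (inj : LocallyInjective f) where

  private
    _↝_ : Fin n → Fin n → Set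
    u ↝ v = Adj G u v × Next M (map f u) (map f v)

    _↝?_ : ∀ u v → Dec (u ↝ v)
    u ↝? v = adj? G u v ×-dec next? (map f u) (map f v)

    orient : ∀ {u v} → Adj G u v → u ↝ v ⊎ v ↝ u
    orient e with preserves f e
    ... | inj₁ p = inj₁ (e , p)
    ... | inj₂ p = inj₂ (symm G e , p)

    -- Both targets are neighbours of `u` lying over the same cyclic successor, so local injectivity
    -- identifies them.
    ↝-functional : ∀ {u v w} → u ↝ v → u ↝ w → v ≡ w
    ↝-functional (d , p) (e , q) = inj d e (next-functional p q)

    ↝-injective : ∀ {u v w} → u ↝ w → v ↝ w → u ≡ v
    ↝-injective (d , p) (e , q) = inj (symm G d) (symm G e) (next-injective p q)

  -- The case of a sink: a 2-colouring by the parity of the number of arrows to it.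

  module Path (r : Fin n) (end : ∀ {u} → ¬ r ↝ u) where

    data Before : Fin n → ℕ → Set where
      here : Before r 0
      back : ∀ {u v d} → u ↝ v → Before v d → Before u (suc d)

    before-unique : ∀ {u d e} → Before u d → Before u e → d ≡ e
    before-unique here       here       = refl
    before-unique here       (back p _) = contradiction p end
    before-unique (back p _) here       = contradiction p end
    before-unique (back p b) (back q c) with refl ← ↝-functional p q =
      cong suc (before-unique b c)

    -- Induction along the walk. A forward edge lengthens the directed path by one. Against an arrow
    -- `v ↝ u`, the directed path from `v` must start with that very arrow, which is then removed.
    before-exists : ∀ {u d} → Walk G u r d → ∃[ e ] Before u e
    before-exists [] = 0 , here
    before-exists (e ∷ w) with orient e | before-exists w
    ... | inj₁ u↝v | d , b        = suc d , back u↝v b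
    ... | inj₂ v↝u | _ , here     = contradiction v↝u end
    ... | inj₂ v↝u | d , back p b with refl ← ↝-functional p v↝u = _ , b

    rank : ∀ u → ∃[ d ] Before u d
    rank u = before-exists (proj₂ (connected u r))

    bipartite : CircularColouring 2 1 G
    -- Arrows are reversed here because the rank increases by one against them.
    bipartite = orientedColouring (swap ∘ orient) (alternate ∘ proj₁ ∘ rank) λ {u} {v} v↝u →
      between-alternate (alternate (proj₁ (rank u))) (cong alternate
        (before-unique (proj₂ (rank v)) (back v↝u (proj₂ (rank u)))))

  -- The case without a sink: the orbit of one vertex is a cycle filling the graph.

  module Cycle (r : Fin n) (next : Fin n → Fin n) (↝-next : ∀ u → u ↝ next u) where

    orbit : ℕ → Fin n
    orbit = iterate r next

    next-inj : ∀ {u v} → next u ≡ next v → u ≡ v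
    next-inj {u} {v} eq = ↝-injective (↝-next u) (subst (v ↝_) (sym eq) (↝-next v))

    -- Since `next` is injective, any repetition in the orbit can be traced back to its start, so
    -- the orbit is purely periodic.
    orbit-cancel : ∀ i {d} → orbit i ≡ orbit (i + d) → orbit d ≡ r
    orbit-cancel zero    eq = sym eq
    orbit-cancel (suc i) eq = orbit-cancel i (next-inj eq)

    orbit-returns : ∃[ d ] orbit (suc d) ≡ r
    orbit-returns with Fin.pigeonhole (ℕ.n<1+n n) (orbit ∘ toℕ)
    ... | i , j , i<j , eq with <-suc∃ i<j
    ...   | d , i+d≡j = d , orbit-cancel (toℕ i) (trans eq (cong orbit (sym i+d≡j)))

    first : ∃[ d ] orbit (suc d) ≡ r × (∀ {i} → i < d → orbit (suc i) ≢ r)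
    first = least {proj₁ orbit-returns} (λ d → orbit (suc d) Fin.≟ r) (proj₂ orbit-returns)

    module Period (last : ℕ) (orbit-period : orbit (suc last) ≡ r)
                  (minimal : ∀ {i} → i < last → orbit (suc i) ≢ r) where

      period : ℕ
      period = suc last

      orbit-distinct : ∀ {i j} → i < j → j < period → orbit i ≢ orbit j
      orbit-distinct {i} i<j (s≤s j≤last) eq with <-suc∃ i<j
      ... | d , refl = minimal
        (ℕ.≤-trans (ℕ.m≤n+m (suc d) i) j≤last) (orbit-cancel i eq)

      orbit-injective : ∀ {i j} → i < period → j < period → orbit i ≡ orbit j → i ≡ j
      orbit-injective {i} {j} i<p j<p eq = ℕ.≤-antisym
        (ℕ.≮⇒≥ λ j<i → orbit-distinct j<i i<p (sym eq)) (ℕ.≮⇒≥ λ i<j → orbit-distinct i<j j<p eq)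

      -- The orbit is closed under successors and, by injectivity, under predecessors, so a walk to
      -- `r` never leaves it.
      covers : ∀ {u d} → Walk G u r d → ∃[ j ] j < period × orbit j ≡ u
      covers [] = 0 , z<s , refl
      covers (e ∷ w) with orient e | covers w
      -- The predecessor of `r` is the last vertex of the orbit.
      ... | inj₁ u↝v | zero , _ , refl = last , ℕ.≤-refl ,
        ↝-injective (subst (orbit last ↝_) orbit-period (↝-next (orbit last))) u↝v
      ... | inj₁ u↝v | suc j , j<p , refl = j , ℕ.<-trans (ℕ.n<1+n j) j<p ,
        ↝-injective (↝-next (orbit j)) u↝v
      ... | inj₂ v↝u | j , j<p , refl with ↝-functional (↝-next (orbit j)) v↝u | ℕ.m≤n⇒m<n∨m≡n j<p
      ...   | refl | inj₁ 1+j<p = suc j , 1+j<p , refl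
      ...   | refl | inj₂ refl  = 0 , z<s , sym orbit-period

      index : ∀ u → ∃[ j ] j < period × orbit j ≡ u
      index u = covers (proj₂ (connected u r))

      colour-orbit : ∀ j → ∃[ c ] toℕ (map f r) + j ≡ toℕ (map f (orbit j)) + c * M
      colour-orbit zero = 0 , refl
      colour-orbit (suc j) with colour-orbit j | next-toℕ (proj₂ (↝-next (orbit j)))
      ... | c , eq | c′ , eq′ = c′ + c , (begin
        toℕ (map f r) + suc j                             ≡⟨ ℕ.+-suc _ j ⟩
        suc (toℕ (map f r) + j)                           ≡⟨ cong suc eq ⟩
        suc (toℕ (map f (orbit j))) + c * M               ≡⟨ cong (_+ c * M) eq′ ⟩
        (toℕ (map f (orbit (suc j))) + c′ * M) + c * M    ≡⟨ lemma _ c′ c M ⟩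
        toℕ (map f (orbit (suc j))) + (c′ + c) * M        ∎)
        where
        open ≡-Reasoning
        lemma : ∀ x c d M → (x + c * M) + d * M ≡ x + (c + d) * M
        lemma = solve-∀

      -- After one period the images in the cycle agree and cancel, leaving `period` as a multiple
      -- of `M`, nonzero since `period` is a successor.
      M≤period : M ≤ period
      M≤period with colour-orbit period
      ... | c , eq rewrite orbit-period with c | ℕ.+-cancelˡ-≡ (toℕ (map f r)) _ _ eq
      ...   | suc d | period≡ = subst (M ≤_) (sym period≡) (ℕ.m≤m+n M (d * M))

      next⇒↝ : {i j : Fin period} → Next period i j → orbit (toℕ i) ↝ orbit (toℕ j)
      next⇒↝ {i} (step p) = subst (λ j → orbit (toℕ i) ↝ orbit j) p (↝-next _)
      next⇒↝ {i} (wrap p q) = subst (orbit (toℕ i) ↝_)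
        (trans (cong orbit p) (trans orbit-period (cong orbit (sym q)))) (↝-next _)

      ↝⇒next : {i j : Fin period} → orbit (toℕ i) ↝ orbit (toℕ j) → Next period i j
      ↝⇒next {i} {j} e with ↝-functional (↝-next _) e | ℕ.m≤n⇒m<n∨m≡n (Fin.toℕ<n i)
      ... | eq | inj₁ 1+i<p = step (orbit-injective 1+i<p (Fin.toℕ<n j) eq)
      ... | eq | inj₂ 1+i≡p = wrap 1+i≡p (orbit-injective (Fin.toℕ<n j) z<s
        (trans (sym eq) (trans (cong orbit 1+i≡p) orbit-period)))

      isomorphism : Isomorphism (cycle period (ℕ.≤-trans 3≤M M≤period)) G
      isomorphism = record
        { to        = orbit ∘ toℕ
        ; injective = λ {i} {j} eq →
            Fin.toℕ-injective (orbit-injective (Fin.toℕ<n i) (Fin.toℕ<n j) eq)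
        ; from      = λ u → fromℕ< (proj₁ (proj₂ (index u)))
        ; to-from   = λ u → trans (cong orbit (Fin.toℕ-fromℕ< (proj₁ (proj₂ (index u)))))
                                  (proj₂ (proj₂ (index u)))
        ; preserves = λ { (inj₁ p) → proj₁ (next⇒↝ p) ; (inj₂ p) → symm G (proj₁ (next⇒↝ p)) }
        ; reflects  = λ e → case orient e of λ
            { (inj₁ p) → inj₁ (↝⇒next p) ; (inj₂ p) → inj₂ (↝⇒next p) }
        }

    cycle-isomorphic : ∃[ N ] Σ[ M≤N ∈ M ≤ N ] Isomorphism (cycle N (ℕ.≤-trans 3≤M M≤N)) G
    cycle-isomorphic with first
    ... | last , eq , minimal = period , M≤period , isomorphism
      where open Period last eq minimal

  -- The given vertex serves as the base point of the orbit when there is no sink.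
  bipartite-or-cycle : Fin n → CircularColouring 2 1 G ⊎
    (∃[ N ] Σ[ M≤N ∈ M ≤ N ] Isomorphism (cycle N (ℕ.≤-trans 3≤M M≤N)) G)
  bipartite-or-cycle r with Fin.any? (λ u → ¬? (Fin.any? (u ↝?_)))
  ... | yes (u , end) = inj₁ (Path.bipartite u λ p → end (_ , p))
  ... | no endless = inj₂ (Cycle.cycle-isomorphic r next ↝-next)
    where
    successor : ∀ u → ∃[ v ] u ↝ v
    successor u = decidable-stable (Fin.any? (u ↝?_)) λ none → endless (u , none)

    next : Fin n → Fin n
    next = proj₁ ∘ successor

    ↝-next : ∀ u → u ↝ next u
    ↝-next = proj₂ ∘ successor

-- Folding until the homomorphism is locally injective.

map-walk : ∀ {u v d} (f : G ⇒ H) → Walk G u v d → Walk H (map f u) (map f v) d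
map-walk f []      = []
map-walk f (e ∷ w) = preserves f e ∷ map-walk f w

connected-image : (f : G ⇒ H) → (∀ v → ∃[ u ] map f u ≡ v) → Connected G → Connected H
connected-image f onto connected a b with onto a | onto b
... | u , refl | v , refl with connected u v
...   | d , w = d , map-walk f w

-- Equal images exclude adjacency of `x` and `y`, as an edge between them would map to a loop of
-- `H`.
commonNeighbour⇒distance2 : {x y w : Fin n} (f : G ⇒ H) → map f x ≡ map f y → x ≢ y →
                            Adj G x w → Adj G w y → Distance G x y 2
commonNeighbour⇒distance2 f fx≡fy x≢y e e′ .walk = e ∷ (e′ ∷ [])
commonNeighbour⇒distance2 f fx≡fy x≢y e e′ .shortest [] = contradiction refl x≢y
commonNeighbour⇒distance2 {G = G} {H = H} {x = x} f fx≡fy x≢y _ _ .shortest (e ∷ []) =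
  contradiction (subst (Adj H (map f x)) (sym fx≡fy) (preserves f e)) (irrefl H)
commonNeighbour⇒distance2 f fx≡fy x≢y e e′ .shortest (_ ∷ (_ ∷ _)) = s≤s (s≤s z≤n)

identify-punchIn : {x y : Fin (suc n)} (y≢x : y ≢ x) (a : Fin n) →
                   identify y≢x (punchIn y a) ≡ a
identify-punchIn {y = y} y≢x a with y Fin.≟ punchIn y a
... | yes eq = contradiction (sym eq) (Fin.punchInᵢ≢i y a)
... | no neq = trans (Fin.punchOut-cong y refl) (Fin.punchOut-punchIn y)

map-punchIn-identify : {A : Set} {x y : Fin (suc n)} (y≢x : y ≢ x) (f : Fin (suc n) → A) →
                       f x ≡ f y → ∀ u → f (punchIn y (identify y≢x u)) ≡ f u
map-punchIn-identify {y = y} y≢x f fx≡fy u with y Fin.≟ u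
... | yes refl = trans (cong f (Fin.punchIn-punchOut y≢x)) fx≡fy
... | no y≢u   = cong f (Fin.punchIn-punchOut y≢u)

module _ {G : Graph (suc n)} {x y : Fin (suc n)} (d : Distance G x y 2) where

  elementaryFold-onto : ∀ a → ∃[ u ] map (elementaryFold G d) u ≡ a
  elementaryFold-onto a = punchIn y a , identify-punchIn (distance2⇒≢ G d) a

  -- `punchIn y` is a section of the identification, and `f` takes one value on the only nontrivial
  -- fibre, so composing with the section factors `f` through the fold.
  descend : (f : G ⇒ H) → map f x ≡ map f y → identified G d ⇒ H
  descend f eq .map = map f ∘ punchIn y
  descend {H = H} f eq .preserves (u , v , refl , refl , e) =
    subst₂ (Adj H) (sym (descends u)) (sym (descends v)) (preserves f e)
    where
    descends = map-punchIn-identify (distance2⇒≢ G d) (map f) eq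

fold-onto : {f : G ⇒ H} → IsFold f → ∀ a → ∃[ u ] map f u ≡ a
fold-onto none a = a , refl
fold-onto (fold d φ) a with fold-onto φ a
... | b , refl with elementaryFold-onto d b
...   | u , refl = u , refl

-- Edges of an identified graph are by definition images of edges, so the image of a fold is its
-- whole target and not a proper subgraph.
fold-onto-edges : {f : G ⇒ H} → IsFold f → ∀ {a b} → Adj H a b →
                  ∃[ u ] ∃[ v ] map f u ≡ a × map f v ≡ b × Adj G u v
fold-onto-edges none e = _ , _ , refl , refl , e
fold-onto-edges (fold d φ) e with fold-onto-edges φ e
... | _ , _ , refl , refl , u , v , refl , refl , e′ = u , v , refl , refl , e′

fold-imageIso : {f : G ⇒ H} {K : Graph m} → IsFold f → Isomorphism K H → ImageIso f K
fold-imageIso {G = G} {H = H} {f = f} {K = K} φ iso = record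
  { to        = to
  ; injective = injective
  ; vertices  = λ w → mk⇔ (λ _ → fold-onto φ w) (λ _ → from w , to-from w)
  ; edges     = λ a b → mk⇔ (λ e → fold-onto-edges φ (Isomorphism.preserves iso e)) λ
      { (u , v , p , q , e) → reflects (subst₂ (Adj H) p q (preserves f e)) }
  }
  where open Isomorphism iso hiding (preserves)

record LocallyInjectiveFold (G : Graph m) (H : Graph n) : Set₁ where
  field
    {size}           : ℕ
    {folded}         : Graph size
    {folding}        : G ⇒ folded
    isFold           : IsFold folding
    connected        : Connected folded
    hom              : folded ⇒ H
    locallyInjective : LocallyInjective hom

precomposeFold : {G : Graph (suc m)} {H : Graph n} {x y : Fin (suc m)} (d : Distance G x y 2) →
                 LocallyInjectiveFold (identified G d) H → LocallyInjectiveFold G H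
precomposeFold d φ = record
  { isFold           = fold d isFold
  ; connected        = connected
  ; hom              = hom
  ; locallyInjective = locallyInjective
  }
  where open LocallyInjectiveFold φ

locallyInjective-or-fold : {G : Graph n} (f : G ⇒ H) → LocallyInjective f ⊎
  (∃[ x ] ∃[ y ] Distance G x y 2 × map f x ≡ map f y)
locallyInjective-or-fold {G = G} f
  with Fin.any? (λ x → Fin.any? λ y → Fin.any? λ w →
         map f x Fin.≟ map f y ×-dec ¬? (x Fin.≟ y) ×-dec adj? G x w ×-dec adj? G w y)
... | yes (x , y , w , fx≡fy , x≢y , e , e′) =
  inj₂ (x , y , commonNeighbour⇒distance2 f fx≡fy x≢y e e′ , fx≡fy)
... | no none′ = inj₁ λ {u} {v} {w} e e′ fu≡fv → decidable-stable (u Fin.≟ v) λ u≢v →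
  none′ (u , v , w , fu≡fv , u≢v , symm G e , e′)

-- Terminates because each elementary fold removes one vertex.
foldLocallyInjective : Connected G → G ⇒ H → LocallyInjectiveFold G H
foldLocallyInjective {zero} connected f = record
  { isFold = none ; connected = connected ; hom = f ; locallyInjective = λ { {()} } }
foldLocallyInjective {suc n} {G = G} connected f with locallyInjective-or-fold f
... | inj₁ inj = record
  { isFold = none ; connected = connected ; hom = f ; locallyInjective = λ {u} → inj {u} }
... | inj₂ (x , y , d , fx≡fy) = precomposeFold d (foldLocallyInjective
  (connected-image (elementaryFold G d) (elementaryFold-onto d) connected) (descend d f fx≡fy))

-- The map onto the image `f(G)` is followed by the inverse of the isomorphism from `H`.
foldsTo⇒colourable : G FoldsTo H → G ⇒ H
foldsTo⇒colourable {G = G} {H = H} (_ , _ , f , _ , image) = record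
  { map       = proj₁ ∘ colour
  ; preserves = λ {u} {v} e → Equivalence.from (edges _ _)
      (u , v , sym (proj₂ (colour u)) , sym (proj₂ (colour v)) , e)
  }
  where
  open ImageIso image
  colour : ∀ u → ∃[ a ] to a ≡ map f u
  colour u = Equivalence.from (vertices (map f u)) (u , refl)

-- The circular chromatic number in terms of natural numbers.

χc-lower : ∀ k .{{_ : NonZero k}} → χc[ G ]≡ (+ (2 * k + 1) / k) →
           ∀ q .{{_ : NonZero q}} → 2 * q ≤ p → CircularColouring p q G →
           (2 * k + 1) * q ≤ p * k
χc-lower {p = p} k@(suc k-1) (_ , minimal) q@(suc q-1) 2q≤p c =
  ℤ.drop‿+≤+ (subst₂ ℤ._≤_ (sym (ℤ.pos-* (2 * k + 1) q)) (sym (ℤ.pos-* p k)) (ℚᵘ.drop-*≤* leᵘ))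
  where
  le : (+ (2 * k + 1) / k) ≤ᵣ (+ p / q)
  le = minimal record { p = p ; q = q ; 2q≤p = 2q≤p ; colouring = c ; ratio = refl }

  leᵘ = ℚᵘ.≤-respʳ-≃ (toℚᵘ-fromℚᵘ (mkℚᵘ (+ p) q-1))
    (ℚᵘ.≤-respˡ-≃ (toℚᵘ-fromℚᵘ (mkℚᵘ (+ (2 * k + 1)) k-1)) (toℚᵘ-mono-≤ le))

ratio-cross : ∀ m k .{{_ : NonZero k}} p q .{{_ : NonZero q}} → + m / k ≡ + p / q → m * q ≡ p * k
ratio-cross m k@(suc k-1) p q@(suc q-1) eq
  with *≡* eqᶻ ← /-injective-≃ (mkℚᵘ (+ m) k-1) (mkℚᵘ (+ p) q-1) eq =
  ℤ.+-injective (trans (ℤ.pos-* m q) (trans eqᶻ (sym (ℤ.pos-* p k))))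

-- The minimum may be attained by an unreduced fraction `p / q`. From `p k = (2k+1) q = k (2q) + q`
-- it follows that `k` divides `q`, and the quotient `c` is the common factor.
χc-colouring : ∀ k .{{_ : NonZero k}} → CircularRatio G (+ (2 * k + 1) / k) →
               ∃[ c ] NonZero c × CircularColouring ((2 * k + 1) * c) (c * k) G
χc-colouring {G = G} k record { p = p ; q = q@(suc _) ; colouring = f ; ratio = ratio }
  with ratio-cross (2 * k + 1) k p q ratio
... | pk≡ with ∣m+n∣m⇒∣n {m = k * (2 * q)} {n = q} (divides p rearranged) (m∣m*n (2 * q))
  where
  lemma : ∀ k q → k * (2 * q) + q ≡ (2 * k + 1) * q
  lemma = solve-∀

  rearranged : k * (2 * q) + q ≡ p * k
  rearranged = trans (lemma k q) pk≡
... | divides c@(suc _) q≡ck = c , _ , subst₂ (λ p q → CircularColouring p q G) p≡ q≡ck f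
  where
  p≡ : p ≡ (2 * k + 1) * c
  p≡ = ℕ.*-cancelʳ-≡ _ _ k (begin
    p * k                 ≡⟨ pk≡ ⟨
    (2 * k + 1) * q       ≡⟨ cong ((2 * k + 1) *_) q≡ck ⟩
    (2 * k + 1) * (c * k) ≡⟨ ℕ.*-assoc (2 * k + 1) c k ⟨
    (2 * k + 1) * c * k   ∎)
    where open ≡-Reasoning

double-suc : ∀ k → suc (k + k) ≡ 2 * k + 1
double-suc = solve-∀

-- From a circular colouring to a homomorphism into the odd cycle.

module _ (k : ℕ) where

  Far : ℕ → ℕ → Set
  Far x y = y ≡ x + k ⊎ y ≡ x + suc k

  shift-/ : ∀ c .{{_ : NonZero c}} b d → (b + d * c) div c ≡ b div c + d
  shift-/ c b d = trans (+-distrib-/-∣ʳ b (n∣m*n d)) (cong (λ e → b div c + e) (m*n/n≡m d c))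

  -- Division by `c` is monotone and turns a shift by `d * c` into a shift by `d`, so the quotients
  -- differ by `k` or `k + 1`.
  far-/ : ∀ c .{{_ : NonZero c}} {a b} → b + k * c ≤ a → a ≤ b + suc k * c → Far (b div c) (a div c)
  far-/ c {a} {b} lo hi with ℕ.m≤n⇒m<n∨m≡n (subst (_≤ a div c) (shift-/ c b k) (/-monoˡ-≤ c lo))
  ... | inj₂ eq = inj₁ (sym eq)
  ... | inj₁ lt = inj₂ (ℕ.≤-antisym (subst (a div c ≤_) (shift-/ c b (suc k)) (/-monoˡ-≤ c hi))
                                    (subst (_≤ a div c) (sym (ℕ.+-suc (b div c) k)) lt))

  far-ordered : ∀ c .{{_ : NonZero c}} {a b} → b ≤ a →
                Between (c * k) ((2 * k + 1) * c) (a ∸ b) → Far (b div c) (a div c)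
  far-ordered c {a} {b} b≤a (between lo hi) = far-/ c
    (subst₂ _≤_ (cong (λ d → b + d) (ℕ.*-comm c k)) (ℕ.m+[n∸m]≡n b≤a) (ℕ.+-monoʳ-≤ b lo))
    (subst₂ _≤_ (ℕ.m+[n∸m]≡n b≤a) (cong (λ d → b + d) gap) (ℕ.+-monoʳ-≤ b hi))
    where
    lemma : ∀ k c → (2 * k + 1) * c ≡ suc k * c + c * k
    lemma = solve-∀
    gap : (2 * k + 1) * c ∸ c * k ≡ suc k * c
    gap = trans (cong (_∸ c * k) (lemma k c)) (ℕ.m+n∸n≡m (suc k * c) (c * k))

  far-colours : ∀ c .{{_ : NonZero c}} a b → Between (c * k) ((2 * k + 1) * c) ∣ a - b ∣ →
                Far (a div c) (b div c) ⊎ Far (b div c) (a div c)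
  far-colours c a b gap with ℕ.≤-total a b
  ... | inj₁ a≤b = inj₁ (far-ordered c a≤b (subst (Between _ _) (ℕ.m≤n⇒∣m-n∣≡n∸m a≤b) gap))
  ... | inj₂ b≤a = inj₂ (far-ordered c b≤a (subst (Between _ _) (ℕ.m≤n⇒∣n-m∣≡n∸m b≤a) gap))

  -- Vertex j of C_{2k+1} corresponds to the colour -k j modulo 2k+1.

  data Position : ℕ → ℕ → Set where
    low  : ∀ {i} → i ≤ k → Position i (i + i)
    high : ∀ {i} → i < k → Position (suc k + i) (suc (i + i))

  position : ∀ {x} → x < 2 * k + 1 → ∃[ j ] Position x j
  position {x} x<2k+1 with x ℕ.≤? k
  ... | yes x≤k = _ , low x≤k
  ... | no x≰k with ℕ.m≤n⇒∃[o]m+o≡n (ℕ.≰⇒> x≰k)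
  ...   | i , refl = _ , high (ℕ.+-cancelˡ-< (suc k) i k
    (subst (suc k + i <_) (sym (double-suc k)) x<2k+1))

  position-< : ∀ {x j} → Position x j → j < 2 * k + 1
  position-< {j = j} (low i≤k) = subst (j <_) (double-suc k) (s≤s (ℕ.+-mono-≤ i≤k i≤k))
  position-< {j = j} (high i<k) =
    subst (j <_) (double-suc k) (s≤s (ℕ.+-mono-≤ i<k (ℕ.<⇒≤ i<k)))

  -- Modulo `2k+1`, adding `k` to a colour moves one step back along the cycle and adding `k + 1`
  -- one step forward. The only wrap is from colour 0 to colour `k`; a forward wrap would need the
  -- colour `2k+1`, which is out of range.
  position-far : ∀ {x y i j} → Far x y → Position x i → Position y j →
                 suc i ≡ j ⊎ suc j ≡ i ⊎ (suc j ≡ 2 * k + 1 × i ≡ 0)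
  position-far (inj₁ eq) (low {zero} _) (low _) rewrite eq = inj₂ (inj₂ (double-suc k , refl))
  position-far (inj₁ eq) (low {suc a} _) (low b≤k) =
    contradiction (subst (_≤ k) eq b≤k) (ℕ.m+n≮n a k)
  position-far (inj₁ eq) (low {a} _) (high {b} _)
    with refl ← ℕ.+-cancelʳ-≡ k a (suc b) (trans (sym eq) (cong suc (ℕ.+-comm k b))) =
    inj₂ (inj₁ (cong suc (sym (ℕ.+-suc b b))))
  position-far (inj₁ eq) (high {a} _) (low b≤k) =
    contradiction (subst (_≤ k) eq b≤k) (ℕ.m+n≮n (k + a) k)
  position-far (inj₁ eq) (high {a} _) (high {b} b<k) =
    contradiction (subst (_< k) (ℕ.+-cancelˡ-≡ (suc k) b (a + k)
                                  (trans eq (ℕ.+-assoc (suc k) a k))) b<k)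
                  (ℕ.m+n≮n a k)
  position-far (inj₂ eq) (low {a} _) (low b≤k) =
    contradiction (subst (_≤ k) (trans eq (ℕ.+-suc a k)) b≤k) (ℕ.m+n≮n a k)
  position-far (inj₂ eq) (low {a} _) (high {b} _)
    with refl ← ℕ.+-cancelˡ-≡ (suc k) b a (trans eq (ℕ.+-comm a (suc k))) = inj₁ refl
  position-far (inj₂ eq) (high {a} _) (low b≤k) =
    contradiction (subst (_≤ k) (trans eq (ℕ.+-suc (suc k + a) k)) b≤k) (ℕ.m+n≮n (suc k + a) k)
  position-far (inj₂ eq) (high {a} _) (high {b} b<k) =
    contradiction (subst (_< k) (ℕ.+-cancelˡ-≡ (suc k) b (a + suc k)
                                  (trans eq (ℕ.+-assoc (suc k) a (suc k)))) b<k)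
                  (λ lt → ℕ.m+n≮n a k (ℕ.≤-trans (s≤s (ℕ.+-monoʳ-≤ a (ℕ.n≤1+n k))) lt))

  colouring⇒cycle : ∀ c .{{_ : NonZero c}} (3≤M : 3 ≤ 2 * k + 1) →
                    CircularColouring ((2 * k + 1) * c) (c * k) G → G ⇒ cycle (2 * k + 1) 3≤M
  colouring⇒cycle {G = G} c 3≤M f = record { map = vertex ; preserves = adjacent }
    where
    open CircularColouring f

    place : ∀ u → ∃[ j ] Position (toℕ (colour u) div c) j
    place u = position (m<n*o⇒m/o<n (Fin.toℕ<n (colour u)))

    vertex : Fin _ → Fin (2 * k + 1)
    vertex u = fromℕ< (position-< (proj₂ (place u)))

    toℕ-vertex : ∀ u → toℕ (vertex u) ≡ proj₁ (place u)
    toℕ-vertex u = Fin.toℕ-fromℕ< (position-< (proj₂ (place u)))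

    near : ∀ u v → Far (toℕ (colour u) div c) (toℕ (colour v) div c) →
           Adj (cycle (2 * k + 1) 3≤M) (vertex u) (vertex v)
    near u v far with position-far far (proj₂ (place u)) (proj₂ (place v))
    ... | inj₁ p =
      inj₁ (step (trans (cong suc (toℕ-vertex u)) (trans p (sym (toℕ-vertex v)))))
    ... | inj₂ (inj₁ p) =
      inj₂ (step (trans (cong suc (toℕ-vertex v)) (trans p (sym (toℕ-vertex u)))))
    ... | inj₂ (inj₂ (p , q)) =
      inj₂ (wrap (trans (cong suc (toℕ-vertex v)) p) (trans (toℕ-vertex u) q))

    adjacent : ∀ {u v} → Adj G u v → Adj (cycle (2 * k + 1) 3≤M) (vertex u) (vertex v)
    adjacent {u} {v} e
      with far-colours c (toℕ (colour u)) (toℕ (colour v)) (between (lower e) (upper e))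
    ... | inj₁ far = near u v far
    ... | inj₂ far = swap (near v u far)

-- Minimality determines the folded graph.

module _ {G : Graph n} (k : ℕ) .{{_ : NonZero k}} (χ : χc[ G ]≡ (+ (2 * k + 1) / k)) where

  ¬bipartite : ¬ CircularColouring 2 1 G
  ¬bipartite c = ℕ.m+1+n≰m (2 * k)
    (subst (_≤ 2 * k) (ℕ.*-identityʳ (2 * k + 1)) (χc-lower k χ 1 ℕ.≤-refl c))

  -- Cross-multiplying `(2k+1)/k ≤ (2t+1)/t` gives `2kt + t ≤ 2kt + k`. The ratio is undefined for
  -- `t = 0`, hence the separate clause.
  oddColouring-≤ : ∀ t → CircularColouring (suc (t + t)) t G → t ≤ k
  oddColouring-≤ zero      _ = z≤n
  oddColouring-≤ t@(suc _) c = ℕ.+-cancelˡ-≤ (2 * k * t) t k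
    (subst₂ _≤_ (lemma₁ k t) (lemma₂ k t) (χc-lower k χ t 2t≤1+2t c))
    where
    2t≤1+2t : 2 * t ≤ suc (t + t)
    2t≤1+2t = ℕ.≤-trans (ℕ.≤-reflexive (cong (λ s → t + s) (ℕ.+-identityʳ t))) (ℕ.n≤1+n (t + t))
    lemma₁ : ∀ k t → (2 * k + 1) * t ≡ 2 * k * t + t
    lemma₁ = solve-∀
    lemma₂ : ∀ k t → suc (t + t) * k ≡ 2 * k * t + k
    lemma₂ = solve-∀

  cycle-length : (3≤N : 3 ≤ N) → G ⇒ cycle N 3≤N → 2 * k + 1 ≤ N → N ≡ 2 * k + 1
  cycle-length {N} 3≤N f M≤N with half N
  ... | t , inj₁ N≡ = contradiction (pullback f (cycle-even {t = t} 3≤N N≡)) ¬bipartite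
  ... | t , inj₂ N≡ = ℕ.≤-antisym
    (ℕ.≤-trans (ℕ.≤-reflexive N≡)
      (subst (suc (t + t) ≤_) (double-suc k) (s≤s (ℕ.+-mono-≤ t≤k t≤k)))) M≤N
    where
    t≤k : t ≤ k
    t≤k = oddColouring-≤ t (subst (λ p → CircularColouring p t G) N≡
      (pullback f (cycle-odd 3≤N N≡)))

  locallyInjective⇒isomorphic : {H : Graph m} (3≤M : 3 ≤ 2 * k + 1) → Connected H → G ⇒ H →
    (f : H ⇒ cycle (2 * k + 1) 3≤M) → LocallyInjective f → Isomorphism (cycle (2 * k + 1) 3≤M) H
  -- The empty graph offers no base point, but it is vacuously 2-colourable.
  locallyInjective⇒isomorphic {zero} 3≤M connected g f inj = contradiction
    (pullback g record { colour = λ () ; lower = λ { {()} } ; upper = λ { {()} } }) ¬bipartite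
  locallyInjective⇒isomorphic {suc m} {H = H} 3≤M connected g f inj
    with bipartite-or-cycle 3≤M connected f inj zero
  ... | inj₁ c = contradiction (pullback g c) ¬bipartite
  ... | inj₂ (N , M≤N , iso) with cycle-length (ℕ.≤-trans 3≤M M≤N) (Isomorphism.fromₕ iso ∘ₕ g) M≤N
  ...   | refl = subst (λ 3≤M → Isomorphism (cycle _ 3≤M) H)
    (ℕ.≤-irrelevant (ℕ.≤-trans 3≤M M≤N) 3≤M) iso

-- The bound `3≤M` is left arbitrary, so that the one inside `C[2_+1]` can be supplied.
χc⇒foldsTo : {G : Graph n} (k : ℕ) .{{_ : NonZero k}} (3≤M : 3 ≤ 2 * k + 1) → Connected G →
             χc[ G ]≡ (+ (2 * k + 1) / k) → G FoldsTo cycle (2 * k + 1) 3≤M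
χc⇒foldsTo k 3≤M connected-G χ@(attained , _) with χc-colouring k attained
... | c , c≢0 , f = size , folded , folding , isFold , fold-imageIso isFold
  (locallyInjective⇒isomorphic k χ 3≤M connected folding hom λ {u} → locallyInjective {u})
  where
  open LocallyInjectiveFold
    (foldLocallyInjective connected-G (colouring⇒cycle k c {{c≢0}} 3≤M f))

corollary4p10 : (k : ℕ) .{{_ : NonZero k}} →
    (∀ {n} (G : Graph n) → Connected G →
    χc[ G ]≡ (+ (2 * k + 1) / k) → G FoldsTo C[2 k +1]) ×
    (∀ {n} (G : Graph n) → G FoldsTo C[2 k +1] → C[2 k +1] -Colourable G)
corollary4p10 k@(suc _) = (λ G → χc⇒foldsTo k (ℕ.+-monoˡ-≤ 1 (ℕ.*-monoʳ-≤ 2 (s≤s z≤n))))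
                        , λ G → foldsTo⇒colourable
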